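{- Let $\iota\colon\mathbb R\hookrightarrow\mathcal R$ be the injection from the Dedekind reals to the continuous dcpo $\mathcal R$ of partial Dedekind reals given by $\iota(L_x,U_x)=\{(p,q)\mid p\in L_x,\ q\in U_x\}$. The image of $\iota$ is exactly the subset of strongly maximal elements of $\mathcal R$.
   Context: Everything is constructive: neither excluded middle nor choice is assumed. A subset $S$ of a poset is directed if it is inhabited and any two elements of $S$ have an upper bound in $S$. A dcpo is a poset $(D,\sqsubseteq)$ in which every directed subset $S$ has a supremum $\bigsqcup S$. Write $x\ll y$ if for every directed $S$ with $y\sqsubseteq\bigsqcup S$ there is $s\in S$ with $x\sqsubseteq s$. $D$ is continuous if for every $x$ the set $\{y\in D\mid y\ll x\}$ is directed with supremum $x$. A subset $U\subseteq D$ is Scott open if it is an upper set and whenever $\bigsqcup S\in U$ with $S$ directed, some $s\in S$ is in $U$. Two points of $D$ are Hausdorff separated if they have disjoint Scott open neighbourhoods. An element $x$ of a continuous dcpo $D$ is strongly maximal if for every $u,v\in D$ with $u\ll v$, we have $u\ll x$, or $v$ and $x$ are Hausdorff separated. A Dedekind real is a pair $x=(L_x,U_x)$ of subsets of $\mathbb Q$ (write $p<x$ for $p\in L_x$ and $x<q$ for $q\in U_x$) that is: bounded (there are $p,q\in\mathbb Q$ with $p<x$ and $x<q$); rounded ($p<x\iff\exists_{r\in\mathbb Q}(p<r\wedge r<x)$ and $x<q\iff\exists_{s\in\mathbb Q}(s<q\wedge x<s)$ for all $p,q\in\mathbb Q$); transitive ($p<x$ and $x<q$ imply $p<q$); located (for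 $p<q$ in $\mathbb Q$, $p<x$ or $x<q$). $\mathbb R$ is the set of Dedekind reals. Let $\mathbb Q\times_<\mathbb Q=\{(p,q)\in\mathbb Q\times\mathbb Q\mid p<q\}$ with $(p,q)\prec(r,s)\iff p<r<s<q$. $\mathcal R$ is the rounded ideal completion of $(\mathbb Q\times_<\mathbb Q,\prec)$: its elements (partial Dedekind reals) are the subsets $I$ that are lower with respect to $\prec$ and directed with respect to $\prec$ (inhabited, and any $a,b\in I$ have some $c\in I$ with $a\prec c$ and $b\prec c$), ordered by inclusion, with directed suprema given by unions. It is a continuous dcpo. -}

module Defs where

open import Data.Product using (_×_; _,_; ∃; ∃-syntax; Σ-syntax; proj₁; proj₂)
open import Data.Rational using (ℚ; _<_; _+_; 1ℚ)
import Data.Rational as ℚ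
import Data.Rational.Properties as ℚ
open import Data.Sum using (_⊎_; inj₁; inj₂)
open import Function using (_∘_)
open import Function.Bundles using (_⇔_; module Equivalence; Injection)
open import Level using (Level; 0ℓ; _⊔_) renaming (suc to lsuc)
open import Relation.Binary.Bundles using (Poset; Setoid)
open import Relation.Binary.PropositionalEquality using (subst)
open import Relation.Nullary using (¬_)
open import Relation.Unary using (Pred; _∈_; _⊆_; _≐_; Satisfiable)
open import Relation.Unary.Properties using (≐-refl; ≐-sym; ≐-trans)

------------------------------------------------------------------------
-- Continuous dcpos
--
-- Subsets of which one takes suprema are given as families (a family
-- stands for the subset of its values, and a subset S for the family
-- Σ D S → D).  Without impredicativity, arbitrary subsets of a large
-- carrier such as that of 𝓡 below are not indexed by a small type, so a
-- dcpo is required to have suprema of directed families indexed by types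
-- in a fixed universe Set i, which also plays the role of the type of
-- propositions in the definition of Scott open subsets.

module _ {c ℓ₁ ℓ₂ : Level} (P : Poset c ℓ₁ ℓ₂) where
  open Poset P renaming (Carrier to D; _≤_ to _⊑_)

  IsDirected : {j : Level} {J : Set j} → (J → D) → Set (ℓ₂ ⊔ j)
  IsDirected {J = J} α =
    J × (∀ (a b : J) → ∃[ k ] (α a ⊑ α k × α b ⊑ α k))

  IsSupremum : {j : Level} {J : Set j} → (J → D) → D → Set (c ⊔ ℓ₂ ⊔ j)
  IsSupremum {J = J} α s =
    (∀ (a : J) → α a ⊑ s) × (∀ (t : D) → (∀ (a : J) → α a ⊑ t) → s ⊑ t)

record DCPO (c ℓ₁ ℓ₂ i : Level) : Set (lsuc (c ⊔ ℓ₁ ⊔ ℓ₂ ⊔ i)) where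
  field
    poset : Poset c ℓ₁ ℓ₂

  open Poset poset public
    using (_≈_) renaming (Carrier to D; _≤_ to _⊑_)

  field
    ⨆            : {J : Set i} (α : J → D) → IsDirected poset α → D
    ⨆-isSupremum : {J : Set i} (α : J → D) (δ : IsDirected poset α) →
                   IsSupremum poset α (⨆ α δ)

  infix 4 _≪_
  _≪_ : D → D → Set (c ⊔ ℓ₂ ⊔ lsuc i)
  x ≪ y = (J : Set i) (α : J → D) (δ : IsDirected poset α) →
          y ⊑ ⨆ α δ → ∃[ j ] x ⊑ α j

  record IsScottOpen (U : Pred D i) : Set (c ⊔ ℓ₂ ⊔ lsuc i) where
    field
      upper        : ∀ {x y} → x ⊑ y → x ∈ U → y ∈ U
      inaccessible : {J : Set i} (α : J → D) (δ : IsDirected poset α) →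
                     ⨆ α δ ∈ U → ∃[ j ] α j ∈ U

  HausdorffSeparated : D → D → Set (c ⊔ ℓ₂ ⊔ lsuc i)
  HausdorffSeparated x y =
    Σ[ U ∈ Pred D i ] Σ[ V ∈ Pred D i ]
      (IsScottOpen U × IsScottOpen V × x ∈ U × y ∈ V ×
       (∀ z → ¬ (z ∈ U × z ∈ V)))

  IsContinuous : Set (c ⊔ ℓ₂ ⊔ lsuc i)
  IsContinuous = ∀ (x : D) →
    let ↡x : (∃[ y ] y ≪ x) → D
        ↡x = proj₁
    in IsDirected poset ↡x × IsSupremum poset ↡x x

record ContinuousDCPO (c ℓ₁ ℓ₂ i : Level) : Set (lsuc (c ⊔ ℓ₁ ⊔ ℓ₂ ⊔ i)) where
  field
    dcpo         : DCPO c ℓ₁ ℓ₂ i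
    isContinuous : DCPO.IsContinuous dcpo

  open DCPO dcpo public

  StronglyMaximal : Pred D (c ⊔ ℓ₂ ⊔ lsuc i)
  StronglyMaximal x =
    ∀ (u v : D) → u ≪ v → (u ≪ x) ⊎ HausdorffSeparated v x

------------------------------------------------------------------------
-- Dedekind reals

record ℝ : Set₁ where
  field
    L U : Pred ℚ 0ℓ
    boundedˡ   : Satisfiable L
    boundedʳ   : Satisfiable U
    roundedˡ   : ∀ p → p ∈ L ⇔ (∃[ r ] (p < r × r ∈ L))
    roundedʳ   : ∀ q → q ∈ U ⇔ (∃[ s ] (s < q × s ∈ U))
    transitive : ∀ p q → p ∈ L → q ∈ U → p < q
    located    : ∀ p q → p < q → p ∈ L ⊎ q ∈ U

ℝ-setoid : Setoid (lsuc 0ℓ) 0ℓ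
ℝ-setoid = record
  { Carrier = ℝ
  ; _≈_ = λ x y → ℝ.L x ≐ ℝ.L y × ℝ.U x ≐ ℝ.U y
  ; isEquivalence = record
    { refl  = ≐-refl , ≐-refl
    ; sym   = λ (l , u) → ≐-sym l , ≐-sym u
    ; trans = λ (l , u) (l′ , u′) → ≐-trans l l′ , ≐-trans u u′
    }
  }

------------------------------------------------------------------------
-- Partial Dedekind reals

ℚ×<ℚ : Set
ℚ×<ℚ = Σ[ (p , q) ∈ ℚ × ℚ ] p < q

infix 4 _≺_
_≺_ : ℚ×<ℚ → ℚ×<ℚ → Set
((p , q) , _) ≺ ((r , s) , _) = p < r × r < s × s < q

record Partialℝ : Set₁ where
  field
    I         : Pred ℚ×<ℚ 0ℓ
    lower     : ∀ {a b} → a ≺ b → b ∈ I → a ∈ I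
    inhabited : Satisfiable I
    directed  : ∀ {a b} → a ∈ I → b ∈ I → ∃[ c ] (c ∈ I × a ≺ c × b ≺ c)

open Partialℝ using (I; lower; inhabited; directed)

𝓡-poset : Poset (lsuc 0ℓ) 0ℓ 0ℓ
𝓡-poset = record
  { Carrier = Partialℝ
  ; _≈_ = λ x y → I x ≐ I y
  ; _≤_ = λ x y → I x ⊆ I y
  ; isPartialOrder = record
    { isPreorder = record
      { isEquivalence = record { refl = ≐-refl ; sym = ≐-sym ; trans = ≐-trans }
      ; reflexive = proj₁
      ; trans = λ f g → g ∘ f
      }
    ; antisym = _,_
    }
  }

⋃ : {J : Set} (α : J → Partialℝ) → IsDirected 𝓡-poset α → Partialℝ
⋃ α (j₀ , semidirected) = record
  { I         = λ a → ∃[ j ] a ∈ I (α j)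
  ; lower     = λ a≺b (j , b∈) → j , lower (α j) a≺b b∈
  ; inhabited = let (a , a∈) = inhabited (α j₀) in a , j₀ , a∈
  ; directed  = λ (j , a∈) (k , b∈) →
      let (m , j⊑m , k⊑m)   = semidirected j k
          (c , c∈ , a≺c , b≺c) = directed (α m) (j⊑m a∈) (k⊑m b∈)
      in c , (m , c∈) , a≺c , b≺c
  }

𝓡-dcpo : DCPO (lsuc 0ℓ) 0ℓ 0ℓ 0ℓ
𝓡-dcpo = record
  { poset = 𝓡-poset
  ; ⨆ = ⋃
  ; ⨆-isSupremum = λ α _ →
      (λ j a∈ → j , a∈) , (λ t bound (j , a∈) → bound j a∈)
  }

≺-trans : ∀ {a b c} → a ≺ b → b ≺ c → a ≺ c
≺-trans (p<r , _ , s<q) (r<t , t<u , u<s) =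
  ℚ.<-trans p<r r<t , t<u , ℚ.<-trans u<s s<q

private
  between-max : ∀ {p p′ r} → p < r → p′ < r → ∃[ m ] (p < m × p′ < m × m < r)
  between-max {p} {p′} p<r p′<r with ℚ.≤-total p p′
  ... | inj₁ p≤p′ = let (m , p′<m , m<r) = ℚ.<-dense p′<r
                    in m , ℚ.≤-<-trans p≤p′ p′<m , p′<m , m<r
  ... | inj₂ p′≤p = let (m , p<m , m<r) = ℚ.<-dense p<r
                    in m , p<m , ℚ.≤-<-trans p′≤p p<m , m<r

  between-min : ∀ {q q′ s} → s < q → s < q′ → ∃[ m ] (s < m × m < q × m < q′)
  between-min {q} {q′} s<q s<q′ with ℚ.≤-total q q′
  ... | inj₁ q≤q′ = let (m , s<m , m<q) = ℚ.<-dense s<q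
                    in m , s<m , m<q , ℚ.<-≤-trans m<q q≤q′
  ... | inj₂ q′≤q = let (m , s<m , m<q′) = ℚ.<-dense s<q′
                    in m , s<m , ℚ.<-≤-trans m<q′ q′≤q , m<q′

  q<q+1 : ∀ q → q < q + 1ℚ
  q<q+1 q = subst (_< q + 1ℚ) (ℚ.+-identityʳ q)
              (ℚ.+-monoʳ-< q (ℚ.positive⁻¹ 1ℚ))

  q-1<q : ∀ q → q + ℚ.- 1ℚ < q
  q-1<q q = subst (q + ℚ.- 1ℚ <_) (ℚ.+-identityʳ q)
              (ℚ.+-monoʳ-< q (ℚ.negative⁻¹ (ℚ.- 1ℚ)))

≺-interpolation : ∀ {a b c} → a ≺ c → b ≺ c → ∃[ d ] (d ≺ c × a ≺ d × b ≺ d)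
≺-interpolation (p<t , t<u , u<q) (r<t , _ , u<s) =
  let (m , p<m , r<m , m<t) = between-max p<t r<t
      (n , u<n , n<q , n<s) = between-min u<q u<s
      m<n = ℚ.<-trans m<t (ℚ.<-trans t<u u<n)
  in ((m , n) , m<n) , (m<t , t<u , u<n) , (p<m , m<n , n<q) , (r<m , m<n , n<s)

↓ : ℚ×<ℚ → Partialℝ
↓ a@((p , q) , p<q) = record
  { I         = _≺ a
  ; lower     = λ {b} {c} b≺c c≺a → ≺-trans {b} {c} {a} b≺c c≺a
  ; inhabited = let p-1<p = q-1<q p ; q<q+1 = q<q+1 q in
                (_ , ℚ.<-trans p-1<p (ℚ.<-trans p<q q<q+1)) , p-1<p , p<q , q<q+1
  ; directed  = λ {b} {c} b≺a c≺a → ≺-interpolation {b} {c} {a} b≺a c≺a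
  }

𝓡-isContinuous : DCPO.IsContinuous 𝓡-dcpo
𝓡-isContinuous x = ((↓ a₀ , ↓≪ {a₀} a₀∈) , upperBound) ,
                   (λ (y , y≪x) → ≪⇒⊑ y y≪x) ,
                   least
  where
  open DCPO 𝓡-dcpo

  a₀  = proj₁ (inhabited x)
  a₀∈ = proj₂ (inhabited x)

  ↓≪ : ∀ {a} → a ∈ I x → ↓ a ≪ x
  ↓≪ {a} a∈ _ α _ x⊑⨆ = let (j , a∈αj) = x⊑⨆ a∈
                      in j , λ {b} b≺a → lower (α j) {b} {a} b≺a a∈αj

  ↓-family : ∃ (I x) → Partialℝ
  ↓-family (a , _) = ↓ a

  ↓-directed : IsDirected 𝓡-poset ↓-family
  ↓-directed = (a₀ , a₀∈) , λ (a , a∈) (b , b∈) →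
    let (c , c∈ , a≺c , b≺c) = directed x a∈ b∈
    in (c , c∈) , (λ {d} d≺a → ≺-trans {d} {a} {c} d≺a a≺c)
                , (λ {d} d≺b → ≺-trans {d} {b} {c} d≺b b≺c)

  ≪⇒⊑↓ : ∀ y → y ≪ x → ∃[ j ] y ⊑ ↓-family j
  ≪⇒⊑↓ y y≪x = y≪x _ ↓-family ↓-directed λ a∈ →
    let (b , b∈ , a≺b , _) = directed x a∈ a∈ in (b , b∈) , a≺b

  ≪⇒⊑ : ∀ y → y ≪ x → y ⊑ x
  ≪⇒⊑ y y≪x {b} b∈y =
    let ((a , a∈) , y⊑↓a) = ≪⇒⊑↓ y y≪x in lower x {b} {a} (y⊑↓a b∈y) a∈

  least : ∀ t → (∀ (y : ∃[ w ] w ≪ x) → proj₁ y ⊑ t) → x ⊑ t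
  least t bound a∈ =
    let (b , b∈ , a≺b , _) = directed x a∈ a∈ in bound (↓ b , ↓≪ {b} b∈) a≺b

  upperBound : ∀ (y z : ∃[ w ] w ≪ x) →
               ∃[ w ] (proj₁ y ⊑ proj₁ w × proj₁ z ⊑ proj₁ w)
  upperBound (y , y≪x) (z , z≪x) =
    let (j , y⊑↓j)             = ≪⇒⊑↓ y y≪x
        (k , z⊑↓k)             = ≪⇒⊑↓ z z≪x
        ((c , c∈) , j⊑c , k⊑c) = proj₂ ↓-directed j k
    in (↓ c , ↓≪ {c} c∈) , (λ {b} b∈y → j⊑c {b} (y⊑↓j b∈y))
                          , (λ {b} b∈z → k⊑c {b} (z⊑↓k b∈z))

𝓡 : ContinuousDCPO (lsuc 0ℓ) 0ℓ 0ℓ 0ℓ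
𝓡 = record { dcpo = 𝓡-dcpo ; isContinuous = 𝓡-isContinuous }

------------------------------------------------------------------------
-- The embedding of the Dedekind reals

module _ (x : ℝ) where
  open ℝ x
  open Equivalence using (to; from)

  private
    ∈L-< : ∀ {p r} → p < r → r ∈ L → p ∈ L
    ∈L-< p<r r∈ = from (roundedˡ _) (_ , p<r , r∈)

    ∈U-< : ∀ {s q} → s < q → s ∈ U → q ∈ U
    ∈U-< s<q s∈ = from (roundedʳ _) (_ , s<q , s∈)

    L-max : ∀ {p p′} → p ∈ L → p′ ∈ L → ∃[ r ] (r ∈ L × p < r × p′ < r)
    L-max {p} {p′} p∈ p′∈ with ℚ.≤-total p p′
    ... | inj₁ p≤p′ = let (r , p′<r , r∈) = to (roundedˡ p′) p′∈
                      in r , r∈ , ℚ.≤-<-trans p≤p′ p′<r , p′<r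
    ... | inj₂ p′≤p = let (r , p<r , r∈) = to (roundedˡ p) p∈
                      in r , r∈ , p<r , ℚ.≤-<-trans p′≤p p<r

    U-min : ∀ {q q′} → q ∈ U → q′ ∈ U → ∃[ s ] (s ∈ U × s < q × s < q′)
    U-min {q} {q′} q∈ q′∈ with ℚ.≤-total q q′
    ... | inj₁ q≤q′ = let (s , s<q , s∈) = to (roundedʳ q) q∈
                      in s , s∈ , s<q , ℚ.<-≤-trans s<q q≤q′
    ... | inj₂ q′≤q = let (s , s<q′ , s∈) = to (roundedʳ q′) q′∈
                      in s , s∈ , ℚ.<-≤-trans s<q′ q′≤q , s<q′

  ι : Partialℝ
  ι = record
    { I         = λ ((p , q) , _) → p ∈ L × q ∈ U
    ; lower     = λ (p<r , _ , s<q) (r∈ , s∈) → ∈L-< p<r r∈ , ∈U-< s<q s∈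
    ; inhabited = let (p , p∈) = boundedˡ ; (q , q∈) = boundedʳ
                  in ((p , q) , transitive p q p∈ q∈) , p∈ , q∈
    ; directed  = λ (p∈ , q∈) (p′∈ , q′∈) →
        let (r , r∈ , p<r , p′<r) = L-max p∈ p′∈
            (s , s∈ , s<q , s<q′) = U-min q∈ q′∈
            r<s = transitive r s r∈ s∈
        in ((r , s) , r<s) , (r∈ , s∈) , (p<r , r<s , s<q) , (p′<r , r<s , s<q′)
    }

ι-injection : Injection ℝ-setoid (Poset.Eq.setoid 𝓡-poset)
ι-injection = record
  { to = ι
  ; cong = λ ((l , l′) , (u , u′)) →
      (λ (p∈ , q∈) → l p∈ , u q∈) , (λ (p∈ , q∈) → l′ p∈ , u′ q∈)
  ; injective = λ {x} {y} (x⊑y , y⊑x) →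
      (L-⊆ x y (λ {a} → x⊑y {a}) , L-⊆ y x (λ {a} → y⊑x {a})) ,
      (U-⊆ x y (λ {a} → x⊑y {a}) , U-⊆ y x (λ {a} → y⊑x {a}))
  }
  where
  L-⊆ : ∀ x y → I (ι x) ⊆ I (ι y) → ℝ.L x ⊆ ℝ.L y
  L-⊆ x y x⊑y {p} p∈ = let (q , q∈) = ℝ.boundedʳ x
    in proj₁ (x⊑y {(p , q) , ℝ.transitive x p q p∈ q∈} (p∈ , q∈))

  U-⊆ : ∀ x y → I (ι x) ⊆ I (ι y) → ℝ.U x ⊆ ℝ.U y
  U-⊆ x y x⊑y {q} q∈ = let (p , p∈) = ℝ.boundedˡ x
    in proj₂ (x⊑y {(p , q) , ℝ.transitive x p q p∈ q∈} (p∈ , q∈))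

{-# OPTIONS --safe #-}
-- Two partial reals v and y are Hausdorff separated precisely when v contains
-- an interval a and y an interval b such that a and b do not overlap.  If u ≪ v
-- then u ⊑ ↓ (p , q) for some (p , q) ≺ (r , s) ∈ I v; for y = ι x, locatedness at
-- p < r and at s < q decides between (p , q) ∈ I y and separation of v and y.
-- Conversely, given p < q, apply strong maximality of y to the principal ideals
-- of intervals (p′ , q′) ≺ (r , s) with (p , q) ≺ (p′ , q′): either (p , q) ∈ I y,
-- or some interval of y lies to the left of q or to the right of p.
module Submission where

open import Defs
open import Data.Product using (_×_; _,_; ∃; ∃-syntax; Σ-syntax)
open import Data.Rational using (ℚ; _<_; _≤_; _⊔_; _⊓_)
import Data.Rational.Properties as ℚ
open import Data.Sum using (_⊎_; inj₁; inj₂)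
open import Function.Bundles using (_⇔_; mk⇔)
open import Relation.Binary.PropositionalEquality using (refl; subst; sym)
open import Relation.Nullary using (¬_; yes; no; contradiction)
open import Relation.Unary using (Pred; _∈_)

open ContinuousDCPO 𝓡 using (_⊑_; _≪_; IsScottOpen; HausdorffSeparated; StronglyMaximal)
open Partialℝ using (I; lower; inhabited; directed)

⊔-lub-< : ∀ {p q r} → p < r → q < r → p ⊔ q < r
⊔-lub-< {p} {q} p<r q<r with ℚ.⊔-sel p q
... | inj₁ eq = subst (_< _) (sym eq) p<r
... | inj₂ eq = subst (_< _) (sym eq) q<r

⊓-glb-< : ∀ {p q r} → r < p → r < q → r < p ⊓ q
⊓-glb-< {p} {q} r<p r<q with ℚ.⊓-sel p q
... | inj₁ eq = subst (_ <_) (sym eq) r<p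
... | inj₂ eq = subst (_ <_) (sym eq) r<q

↓-family : (y : Partialℝ) → ∃ (I y) → Partialℝ
↓-family _ (a , _) = ↓ a

↓-family-directed : ∀ y → IsDirected 𝓡-poset (↓-family y)
↓-family-directed y = inhabited y , λ (a , a∈) (b , b∈) →
  let (c , c∈ , a≺c , b≺c) = directed y a∈ b∈
  in (c , c∈) , (λ {d} d≺a → ≺-trans {d} {a} {c} d≺a a≺c)
              , (λ {d} d≺b → ≺-trans {d} {b} {c} d≺b b≺c)

-- Roundedness: pairing a member with itself in `directed` yields a member strictly inside it.
⊑-⋃↓ : ∀ y → y ⊑ ⋃ (↓-family y) (↓-family-directed y)
⊑-⋃↓ y a∈ = let (c , c∈ , a≺c , _) = directed y a∈ a∈ in (c , c∈) , a≺c

↓≪ : ∀ {a} y → a ∈ I y → ↓ a ≪ y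
↓≪ {a} y a∈ _ α _ y⊑⨆ = let (j , a∈αj) = y⊑⨆ a∈
                        in j , λ {b} b≺a → lower (α j) {b} {a} b≺a a∈αj

⊑-≪-trans : ∀ {x y z} → x ⊑ y → y ≪ z → x ≪ z
⊑-≪-trans x⊑y y≪z J α δ z⊑⨆ = let (j , y⊑αj) = y≪z J α δ z⊑⨆
                               in j , λ a∈ → y⊑αj (x⊑y a∈)

≪⇒⊑ : ∀ x y → x ≪ y → x ⊑ y
≪⇒⊑ x y x≪y {b} b∈ =
  let ((a , a∈) , x⊑↓a) = x≪y _ (↓-family y) (↓-family-directed y) (⊑-⋃↓ y)
  in lower y {b} {a} (x⊑↓a b∈) a∈

-- Directed suprema are unions, so inaccessibility is immediate.
∈-isScottOpen : ∀ a → IsScottOpen (λ y → a ∈ I y)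
∈-isScottOpen a = record
  { upper        = λ x⊑y a∈x → x⊑y a∈x
  ; inaccessible = λ _ _ a∈⨆ → a∈⨆
  }

∈-open⇒↓∈ : ∀ {U} → IsScottOpen U → ∀ y → y ∈ U → ∃[ a ] (a ∈ I y × ↓ a ∈ U)
∈-open⇒↓∈ U-open y y∈U =
  let ((a , a∈) , ↓a∈U) = inaccessible (↓-family y) (↓-family-directed y)
                            (upper (λ {a} → ⊑-⋃↓ y {a}) y∈U)
  in a , a∈ , ↓a∈U
  where open IsScottOpen U-open

-- A shared endpoint is allowed: a common refinement under `≺` would have to lie strictly inside
-- both intervals.
Disjoint : ℚ×<ℚ → ℚ×<ℚ → Set
Disjoint ((p , q) , _) ((r , s) , _) = q ≤ r ⊎ s ≤ p

disjoint⇒no-refinement : ∀ {a b c} → Disjoint a b → a ≺ c → ¬ b ≺ c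
disjoint⇒no-refinement (inj₁ q≤r) (_ , m<n , n<q) (r<m , _) =
  ℚ.<-irrefl refl (ℚ.<-trans m<n (ℚ.<-trans (ℚ.<-≤-trans n<q q≤r) r<m))
disjoint⇒no-refinement (inj₂ s≤p) (p<m , m<n , _) (_ , _ , n<s) =
  ℚ.<-irrefl refl (ℚ.<-trans m<n (ℚ.<-trans (ℚ.<-≤-trans n<s s≤p) p<m))

disjoint⇒separated : ∀ {a b} v y → a ∈ I v → b ∈ I y → Disjoint a b →
                     HausdorffSeparated v y
disjoint⇒separated {a} {b} v y a∈v b∈y a#b =
  (λ z → a ∈ I z) , (λ z → b ∈ I z) ,
  ∈-isScottOpen a , ∈-isScottOpen b , a∈v , b∈y ,
  λ z (a∈z , b∈z) → let (c , _ , a≺c , b≺c) = directed z a∈z b∈z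
                    in disjoint⇒no-refinement {a} {b} {c} a#b a≺c b≺c

-- The order on `ℚ` is decidable, and overlapping intervals meet in an interval `c`. As `c` may
-- share endpoints with `a` or `b`, the conclusion compares principal ideals instead of claiming
-- `a ≺ c`.
disjoint-or-overlapping : ∀ a b → Disjoint a b ⊎ ∃[ c ] (↓ a ⊑ ↓ c × ↓ b ⊑ ↓ c)
disjoint-or-overlapping ((p , q) , p<q) ((r , s) , r<s)
  with r ℚ.<? q | p ℚ.<? s
... | no r≮q  | _       = inj₁ (inj₁ (ℚ.≮⇒≥ r≮q))
... | yes _   | no p≮s  = inj₁ (inj₂ (ℚ.≮⇒≥ p≮s))
... | yes r<q | yes p<s = inj₂ (((p ⊔ r , q ⊓ s) , m<n) ,
    (λ (t<p , _ , q<u) → ℚ.<-≤-trans t<p (ℚ.p≤p⊔q p r) , m<n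
                       , ℚ.≤-<-trans (ℚ.p⊓q≤p q s) q<u)
  , (λ (t<r , _ , s<u) → ℚ.<-≤-trans t<r (ℚ.p≤q⊔p p r) , m<n
                       , ℚ.≤-<-trans (ℚ.p⊓q≤q q s) s<u))
  where
  m<n : p ⊔ r < q ⊓ s
  m<n = ⊔-lub-< (⊓-glb-< p<q p<s) (⊓-glb-< r<q r<s)

-- Both opens already contain principal ideals below their points; if the two intervals overlapped,
-- `↓ c` would lie in both opens.
separated⇒disjoint : ∀ v y → HausdorffSeparated v y →
                     ∃[ a ] ∃[ b ] (a ∈ I v × b ∈ I y × Disjoint a b)
separated⇒disjoint v y (U , V , U-open , V-open , v∈U , y∈V , U∩V≡∅)
  with ∈-open⇒↓∈ U-open v v∈U | ∈-open⇒↓∈ V-open y y∈V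
... | a , a∈v , ↓a∈U | b , b∈y , ↓b∈V with disjoint-or-overlapping a b
...   | inj₁ a#b                 = a , b , a∈v , b∈y , a#b
...   | inj₂ (c , ↓a⊑↓c , ↓b⊑↓c) = contradiction
  ( IsScottOpen.upper U-open (λ {d} → ↓a⊑↓c {d}) ↓a∈U
  , IsScottOpen.upper V-open (λ {d} → ↓b⊑↓c {d}) ↓b∈V )
  (U∩V≡∅ (↓ c))

-- The image of `ι` is taken up to `≈`; allowing any `y` equivalent to `ι x` avoids transporting
-- strong maximality.
ι-stronglyMaximal : ∀ x y → y ⊑ ι x → ι x ⊑ y → StronglyMaximal y
ι-stronglyMaximal x y y⊑ιx ιx⊑y u v u≪v
  with u≪v _ (↓-family v) (↓-family-directed v) (⊑-⋃↓ v)
... | (((p , q) , p<q) , a∈v) , u⊑↓a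
  with directed v a∈v a∈v
... | ((r , s) , r<s) , c∈v , (p<r , _ , s<q) , _
  with ℝ.located x p r p<r | ℝ.located x s q s<q
-- Here `x` lies left of `r`, so the interval `(l , r)` of `y` only touches `(r , s)`.
... | inj₂ r∈U | _        =
  let (l , l∈L) = ℝ.boundedˡ x
      l<r       = ℝ.transitive x l r l∈L r∈U
  in inj₂ (disjoint⇒separated {(r , s) , r<s} {(l , r) , l<r} v y c∈v
             (ιx⊑y (l∈L , r∈U)) (inj₂ ℚ.≤-refl))
... | inj₁ _   | inj₁ s∈L =
  let (m , m∈U) = ℝ.boundedʳ x
      s<m       = ℝ.transitive x s m s∈L m∈U
  in inj₂ (disjoint⇒separated {(r , s) , r<s} {(s , m) , s<m} v y c∈v
             (ιx⊑y (s∈L , m∈U)) (inj₁ ℚ.≤-refl))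
... | inj₁ p∈L | inj₂ q∈U =
  inj₁ (⊑-≪-trans {u} {↓ ((p , q) , p<q)} {y} u⊑↓a
          (↓≪ y (ιx⊑y {(p , q) , p<q} (p∈L , q∈U))))

module _ (y : Partialℝ) where

  Lower Upper : Pred ℚ _
  Lower p = ∃[ q ] Σ[ p<q ∈ p < q ] ((p , q) , p<q) ∈ I y
  Upper q = ∃[ p ] Σ[ p<q ∈ p < q ] ((p , q) , p<q) ∈ I y

  Lower-< : ∀ {p r} → p < r → r ∈ Lower → p ∈ Lower
  Lower-< p<r (s , r<s , a∈) =
    -- `(p , s)` shares its right endpoint with `(r , s)`, so `lower` applies only after shrinking
    -- to `(m , n)`.
    let (((m , n) , m<n) , c∈ , (r<m , _ , n<s) , _) = directed y a∈ a∈
        p<m = ℚ.<-trans p<r r<m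
    in s , ℚ.<-trans p<r r<s , lower y (p<m , m<n , n<s) c∈

  Upper-< : ∀ {s q} → s < q → s ∈ Upper → q ∈ Upper
  Upper-< s<q (r , r<s , a∈) =
    let (((m , n) , m<n) , c∈ , (r<m , _ , n<s) , _) = directed y a∈ a∈
        n<q = ℚ.<-trans n<s s<q
    in r , ℚ.<-trans r<s s<q , lower y (r<m , m<n , n<q) c∈

  Lower-rounded : ∀ {p} → p ∈ Lower → ∃[ r ] (p < r × r ∈ Lower)
  Lower-rounded (_ , _ , a∈) =
    let (((m , n) , m<n) , c∈ , (p<m , _) , _) = directed y a∈ a∈
    in m , p<m , n , m<n , c∈

  Upper-rounded : ∀ {q} → q ∈ Upper → ∃[ s ] (s < q × s ∈ Upper)
  Upper-rounded (_ , _ , a∈) =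
    let (((m , n) , m<n) , c∈ , (_ , _ , n<q) , _) = directed y a∈ a∈
    in n , n<q , m , m<n , c∈

  Lower∧Upper⇒< : ∀ {p q} → p ∈ Lower → q ∈ Upper → p < q
  Lower∧Upper⇒< (_ , _ , a∈) (_ , _ , b∈) =
    let (_ , _ , (p<m , m<n , _) , (_ , _ , n<q)) = directed y a∈ b∈
    in ℚ.<-trans p<m (ℚ.<-trans m<n n<q)

  -- The two endpoints may come from different intervals of `y`; a common refinement of these lies
  -- strictly inside `(p , q)`.
  Lower∧Upper⇒∈ : ∀ {p q} (p<q : p < q) → p ∈ Lower → q ∈ Upper →
                  ((p , q) , p<q) ∈ I y
  Lower∧Upper⇒∈ p<q (_ , _ , a∈) (_ , _ , b∈) =
    let (_ , c∈ , (p<m , m<n , _) , (_ , _ , n<q)) = directed y a∈ b∈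
    in lower y (p<m , m<n , n<q) c∈

  stronglyMaximal⇒located : StronglyMaximal y →
                            ∀ p q → p < q → p ∈ Lower ⊎ q ∈ Upper
  stronglyMaximal⇒located max p q p<q
    -- The chain is `p < p′ < r < s < q′ < q`: the inner gaps give `u ≪ v`, the outer ones put
    -- `(p , q)` into `u`.
    with r , p<r , r<q ← ℚ.<-dense p<q
    with s , r<s , s<q ← ℚ.<-dense r<q
    with p′ , p<p′ , p′<r ← ℚ.<-dense p<r
    with q′ , s<q′ , q′<q ← ℚ.<-dense s<q
    with p′<q′ ← ℚ.<-trans p′<r (ℚ.<-trans r<s s<q′)
    with max (↓ ((p′ , q′) , p′<q′)) (↓ ((r , s) , r<s))
             (↓≪ {(p′ , q′) , p′<q′} (↓ ((r , s) , r<s)) (p′<r , r<s , s<q′))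
  ... | inj₁ u≪y =
    inj₁ (q , p<q , ≪⇒⊑ (↓ ((p′ , q′) , p′<q′)) y u≪y (p<p′ , p′<q′ , q′<q))
  ... | inj₂ separated
    with separated⇒disjoint (↓ ((r , s) , r<s)) y separated
  -- The interval `(r′ , s′)` of `v` surrounds `(r , s)`, so an interval of `y` to its right starts
  -- beyond `p`, and one to its left ends before `q`.
  ... | ((r′ , s′) , _) , ((t , w) , t<w) , (r′<r , _ , s<s′) , b∈y , inj₁ s′≤t =
    inj₁ (Lower-< (ℚ.<-trans p<r (ℚ.<-trans r<s (ℚ.<-≤-trans s<s′ s′≤t)))
                  (w , t<w , b∈y))
  ... | ((r′ , s′) , _) , ((t , w) , t<w) , (r′<r , _ , s<s′) , b∈y , inj₂ w≤r′ =
    inj₂ (Upper-< (ℚ.≤-<-trans w≤r′ (ℚ.<-trans r′<r r<q)) (t , t<w , b∈y))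

  stronglyMaximal⇒ℝ : StronglyMaximal y → ℝ
  stronglyMaximal⇒ℝ max = record
    { L          = Lower
    ; U          = Upper
    ; boundedˡ   = let (((p , q) , p<q) , a∈) = inhabited y in p , q , p<q , a∈
    ; boundedʳ   = let (((p , q) , p<q) , a∈) = inhabited y in q , p , p<q , a∈
    ; roundedˡ   = λ _ → mk⇔ Lower-rounded (λ (_ , p<r , r∈) → Lower-< p<r r∈)
    ; roundedʳ   = λ _ → mk⇔ Upper-rounded (λ (_ , s<q , s∈) → Upper-< s<q s∈)
    ; transitive = λ _ _ → Lower∧Upper⇒<
    ; located    = stronglyMaximal⇒located max
    }

theorem7p15 : ∀ (y : Partialℝ) →
    (Σ[ x ∈ ℝ ] ContinuousDCPO._≈_ 𝓡 (ι x) y) ⇔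
    ContinuousDCPO.StronglyMaximal 𝓡 y
theorem7p15 y = mk⇔
  (λ (x , ιx⊑y , y⊑ιx) →
    ι-stronglyMaximal x y (λ {a} → y⊑ιx {a}) (λ {a} → ιx⊑y {a}))
  (λ max → stronglyMaximal⇒ℝ y max ,
    (λ {(_ , p<q)} (p∈ , q∈) → Lower∧Upper⇒∈ y p<q p∈ q∈) ,
    (λ {((p , q) , p<q)} a∈ → (q , p<q , a∈) , (p , p<q , a∈)))
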